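{- $[\mathcal{R}\mathbf{Txt}\mathbf{Sd}\mathbf{CInd}\mathbf{Ex}_C]_{\mathbf{REC}} \subsetneq [\mathbf{Txt}\mathbf{Sd}\mathbf{CInd}\mathbf{Ex}_C]_{\mathbf{REC}}$.
   Context: Fix an acceptable numbering $(\varphi_e)_{e\in\mathbb{N}}$ of all partial computable functions. A number $e$ is a $C$-index if $\varphi_e$ is total with values in $\{0,1\}$; then $C_e=\{x:\varphi_e(x)=1\}$. $\mathbf{REC}$ is the collection of recursive subsets of $\mathbb{N}$; $\mathcal{P}$ and $\mathcal{R}$ are the partial computable and total computable functions. Fix a pause symbol $\#$. A text is a total function $T:\mathbb{N}\to\mathbb{N}\cup\{\#\}$, $\mathrm{content}(T)=\mathrm{range}(T)\setminus\{\#\}$, $T$ is a text for $L$ if $\mathrm{content}(T)=L$, $T[n]=(T(0),\dots,T(n-1))$. A learner is some $h\in\mathcal{P}$ (finite sets coded as numbers). Set-driven hypothesis sequence: $\mathbf{Sd}(h,T)(i)=h(\mathrm{content}(T[i]))$. Restrictions on a hypothesis sequence $p$ and text $T$: $\mathbf{Ex}_C$: there is $n_0$ with $p(n)=p(n_0)$ for all $n\ge n_0$ and $p(n_0)$ a $C$-index with $C_{p(n_0)}=\mathrm{content}(T)$; $\mathbf{CInd}$: for all $i$, $p(i)$ is a $C$-index. Juxtaposition means conjunction. For $\mathcal{C}\in\{\mathcal{P},\mathcal{R}\}$ (omitted means $\mathcal{P}$), $h\in\mathcal{C}$ $\mathcal{C}\mathbf{Txt}\beta\delta$-learns $L$ iff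 $\delta(\beta(h,T),T)$ holds for every text $T$ for $L$; $[\mathcal{C}\mathbf{Txt}\beta\delta]_{\mathbf{REC}}$ is the set of all classes $\mathcal{L}\subseteq\mathbf{REC}$ for which some $h\in\mathcal{C}$ learns every $L\in\mathcal{L}$. -}

module Defs where

open import Data.Nat using (ℕ; zero; suc; _+_; _*_; _^_; _≤_; _<_)
open import Data.Bool using (Bool; true; false; if_then_else_)
open import Data.Maybe using (Maybe; just; nothing)
open import Data.Product using (Σ; ∃; ∃-syntax; _×_; _,_; proj₁; proj₂)
open import Data.Sum using (_⊎_)
open import Relation.Binary.PropositionalEquality using (_≡_)
open import Relation.Nullary using (¬_)

-- Cantor pairing.  unpair enumerates ℕ×ℕ as
-- (0,0),(1,0),(0,1),(2,0),(1,1),(0,2),…  and pair is its inverse.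

unpair : ℕ → ℕ × ℕ
unpair zero = 0 , 0
unpair (suc e) with unpair e
... | zero    , b = suc b , 0
... | suc a   , b = a , suc b

tri : ℕ → ℕ
tri zero    = zero
tri (suc d) = suc d + tri d

pair : ℕ → ℕ → ℕ
pair a b = tri (a + b) + b

-- A concrete programming system for the unary partial computable
-- functions (a standard complete basis w.r.t. the pairing above).

data Code : Set where
  Zc Sc Ic Lc Rc : Code
  Pc Cc Recc     : Code → Code → Code
  Muc            : Code → Code

mutual
  data Eval : Code → ℕ → ℕ → Set where
    evZ   : ∀ {x} → Eval Zc x 0
    evS   : ∀ {x} → Eval Sc x (suc x)
    evI   : ∀ {x} → Eval Ic x x
    evL   : ∀ {x} → Eval Lc x (proj₁ (unpair x))
    evR   : ∀ {x} → Eval Rc x (proj₂ (unpair x))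
    evP   : ∀ {f g x a b} → Eval f x a → Eval g x b → Eval (Pc f g) x (pair a b)
    evC   : ∀ {f g x y z} → Eval g x y → Eval f y z → Eval (Cc f g) x z
    evRec : ∀ {f g w y} →
            EvalRec f g (proj₁ (unpair w)) (proj₂ (unpair w)) y →
            Eval (Recc f g) w y
    evMu  : ∀ {f x n} → Eval f (pair x n) 0 →
            (∀ m → m < n → Σ ℕ λ k → Eval f (pair x m) (suc k)) →
            Eval (Muc f) x n

  data EvalRec (f g : Code) (x : ℕ) : ℕ → ℕ → Set where
    recZ : ∀ {y} → Eval f x y → EvalRec f g x 0 y
    recS : ∀ {n y z} → EvalRec f g x n y → Eval g (pair x (pair n y)) z →
           EvalRec f g x (suc n) z

-- Gödel numbering of programs (fuel = the number itself suffices,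
-- since the components of unpair e are ≤ e).
decode′ : ℕ → ℕ → Code
decode′ zero    e = Zc
decode′ (suc k) e with unpair e
... | 0 , r = Zc
... | 1 , r = Sc
... | 2 , r = Ic
... | 3 , r = Lc
... | 4 , r = Rc
... | 5 , r = Pc (decode′ k (proj₁ (unpair r))) (decode′ k (proj₂ (unpair r)))
... | 6 , r = Cc (decode′ k (proj₁ (unpair r))) (decode′ k (proj₂ (unpair r)))
... | 7 , r = Recc (decode′ k (proj₁ (unpair r))) (decode′ k (proj₂ (unpair r)))
... | 8 , r = Muc (decode′ k r)
... | _ , r = Zc

decode : ℕ → Code
decode e = decode′ e e

φ : ℕ → ℕ → ℕ → Set
φ e x y = Eval (decode e) x y

Total : ℕ → Set
Total e = ∀ x → ∃[ y ] φ e x y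

Lang : Set
Lang = ℕ → Bool

CIndex : ℕ → Set
CIndex e = ∀ x → ∃[ y ] (φ e x y × (y ≡ 0 ⊎ y ≡ 1))

CIndexFor : ℕ → Lang → Set
CIndexFor e L = CIndex e × (∀ x → (φ e x 1 → L x ≡ true) × (L x ≡ true → φ e x 1))

REC : Lang → Set
REC L = ∃[ e ] CIndexFor e L

-- Texts (nothing = pause symbol #)

Text : Set
Text = ℕ → Maybe ℕ

TextFor : Text → Lang → Set
TextFor T L = ∀ x → (L x ≡ true → ∃[ n ] (T n ≡ just x)) × (∃[ n ] (T n ≡ just x) → L x ≡ true)

-- canonical coding of finite sets: D = {x : bit x of the code is 1}
half : ℕ → ℕ
half zero          = zero
half (suc zero)    = zero
half (suc (suc n)) = suc (half n)

odd : ℕ → Bool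
odd zero          = false
odd (suc zero)    = true
odd (suc (suc n)) = odd n

testBit : ℕ → ℕ → Bool
testBit zero    c = odd c
testBit (suc x) c = testBit x (half c)

insertCode : Maybe ℕ → ℕ → ℕ
insertCode nothing  c = c
insertCode (just x) c = if testBit x c then c else c + 2 ^ x

contentCode : Text → ℕ → ℕ
contentCode T zero    = zero
contentCode T (suc i) = insertCode (T i) (contentCode T i)

-- Set-driven learning, CInd and Ex_C.
-- Sd(h,T)(i) = φ_h(contentCode T i).

SdCIndExC-learns : ℕ → Lang → Set
SdCIndExC-learns h L = ∀ T → TextFor T L →
    (∀ i → ∃[ p ] (φ h (contentCode T i) p × CIndex p))
  ×
    (∃[ n₀ ] ∃[ p ] (φ h (contentCode T n₀) p × CIndexFor p L
                     × (∀ n → n₀ ≤ n → φ h (contentCode T n) p)))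

Class : Set₁
Class = Lang → Set

InTxtSdCIndExC : Class → Set
InTxtSdCIndExC 𝓛 = (∀ L → 𝓛 L → REC L) × ∃[ h ] (∀ L → 𝓛 L → SdCIndExC-learns h L)

InRTxtSdCIndExC : Class → Set
InRTxtSdCIndExC 𝓛 = (∀ L → 𝓛 L → REC L) × ∃[ h ] (Total h × (∀ L → 𝓛 L → SdCIndExC-learns h L))

{-# OPTIONS --safe #-}

-- The second coordinate of a pair being free, a language can carry a number e in
-- the first coordinate of each of its elements. For total φₑ, run through the
-- numbers n tagged with e in increasing order and add n to the finite set collected
-- so far whenever this makes φₑ change its mind; call the result diag e. If φₑ learns
-- diag e, then diag e is finite, and for all large n tagged with e the conjecture of φₑ
-- on diag e ∪ {n} is that on diag e, so φₑ does not learn both. A partial learner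
-- reads e off any element of the input D, conjectures diag e if D ⊆ diag e and D
-- otherwise: this test may diverge when φₑ is not total, but then no language of the
-- family is tagged with e.
module Submission where

open import Defs
open import Data.Nat using (ℕ; zero; suc; pred; _+_; _*_; _∸_; _^_; _⊔_; _≤_; _<_; z≤n; s≤s; s≤s⁻¹; _≡ᵇ_; _<?_)
open import Data.Nat.Properties
open import Data.Bool using (Bool; true; false; not; _∧_; _∨_; if_then_else_)
open import Data.Bool.Properties using (∨-identityʳ; ∨-zeroʳ; ∧-zeroʳ)
open import Data.Maybe using (Maybe; just; nothing)
open import Data.Maybe.Properties using (just-injective)
open import Data.Product using (Σ; ∃-syntax; _×_; _,_; proj₁; proj₂)
open import Data.Sum using (_⊎_; inj₁; inj₂)
open import Data.Empty using (⊥; ⊥-elim)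
open import Relation.Nullary using (¬_; yes; no)
open import Relation.Binary.Definitions using (tri<; tri≈; tri>)
open import Relation.Binary.PropositionalEquality

-- Cantor pairing and its projections.

pair-suc-zero : ∀ a → pair (suc a) 0 ≡ suc (pair 0 a)
pair-suc-zero a rewrite +-identityʳ a | +-identityʳ (a + tri a) = cong suc (+-comm a (tri a))

pair-sucʳ : ∀ a b → pair a (suc b) ≡ suc (pair (suc a) b)
pair-sucʳ a b rewrite +-suc a b = +-suc (suc (a + b + tri (a + b))) b

unpair-suc-zero : ∀ e {b} → unpair e ≡ (0 , b) → unpair (suc e) ≡ (suc b , 0)
unpair-suc-zero e eq rewrite eq = refl

unpair-sucˡ : ∀ e {a b} → unpair e ≡ (suc a , b) → unpair (suc e) ≡ (a , suc b)
unpair-sucˡ e eq rewrite eq = refl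

unpair-pair : ∀ a b → unpair (pair a b) ≡ (a , b)
unpair-pair a b = onDiagonal (a + b) a b refl
  where
  -- Induction in the order of the enumeration: within a diagonal `b` decreases, and at `b = 0` the
  -- predecessor is the end of the preceding diagonal, so `s` decreases.
  onDiagonal : ∀ s a b → a + b ≡ s → unpair (pair a b) ≡ (a , b)
  onDiagonal zero    zero    zero    _  = refl
  onDiagonal (suc s) (suc a) zero    eq =
    trans (cong unpair (pair-suc-zero a))
          (unpair-suc-zero (pair 0 a) (onDiagonal s 0 a (trans (sym (+-identityʳ a)) (suc-injective eq))))
  onDiagonal s       a       (suc b) eq =
    trans (cong unpair (pair-sucʳ a b))
          (unpair-sucˡ (pair (suc a) b) (onDiagonal s (suc a) b (trans (sym (+-suc a b)) eq)))

-- Sealed so that paired numbers stay symbolic; the seal is opened where `decode′` and `Eval`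
-- mention `pair` and `unpair` themselves.
opaque
  ⟪_,_⟫ : ℕ → ℕ → ℕ
  ⟪ a , b ⟫ = pair a b

  π₁ π₂ : ℕ → ℕ
  π₁ n = proj₁ (unpair n)
  π₂ n = proj₂ (unpair n)

  β₁ : ∀ a b → π₁ ⟪ a , b ⟫ ≡ a
  β₁ a b = cong proj₁ (unpair-pair a b)

  β₂ : ∀ a b → π₂ ⟪ a , b ⟫ ≡ b
  β₂ a b = cong proj₂ (unpair-pair a b)

  ≤-pairʳ : ∀ a b → b ≤ ⟪ a , b ⟫
  ≤-pairʳ a b = m≤n+m b (tri (a + b))

  ≤-pairˡ : ∀ a b → a ≤ ⟪ a , b ⟫
  ≤-pairˡ a b = ≤-trans (m≤m+n a b) (≤-trans (n≤tri (a + b)) (m≤m+n (tri (a + b)) b))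
    where
    n≤tri : ∀ n → n ≤ tri n
    n≤tri zero    = z≤n
    n≤tri (suc n) = m≤m+n (suc n) (tri n)

  -- A positive first component makes the triangular summand positive. Tags other than 0 thus pay
  -- for one unit of decoding fuel.
  <-pairʳ : ∀ a b → b < ⟪ suc a , b ⟫
  <-pairʳ a b = +-monoˡ-≤ b (s≤s z≤n)

-- Determinism of evaluation.

Eval-functional : ∀ {c x y z} → Eval c x y → Eval c x z → y ≡ z
EvalRec-functional : ∀ {f g x n y z} → EvalRec f g x n y → EvalRec f g x n z → y ≡ z
Eval-functional evZ evZ = refl
Eval-functional evS evS = refl
Eval-functional evI evI = refl
Eval-functional evL evL = refl
Eval-functional evR evR = refl
Eval-functional (evP p q) (evP p′ q′) = cong₂ pair (Eval-functional p p′) (Eval-functional q q′)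
Eval-functional (evC p q) (evC p′ q′) with refl ← Eval-functional p p′ = Eval-functional q q′
Eval-functional (evRec p) (evRec p′) = EvalRec-functional p p′
-- If the two results differed, the body would give 0 at the smaller one and, since it lies below
-- the larger, also a successor.
Eval-functional {y = y} {z} (evMu p least) (evMu p′ least′) with <-cmp y z
... | tri< y<z _ _ with () ← Eval-functional p (proj₂ (least′ y y<z))
... | tri≈ _ eq _ = eq
... | tri> _ _ z<y with () ← Eval-functional (proj₂ (least z z<y)) p′
EvalRec-functional (recZ p) (recZ p′) = Eval-functional p p′
EvalRec-functional (recS p q) (recS p′ q′) with refl ← EvalRec-functional p p′ = Eval-functional q q′

-- Gödel numbers of programs.

encode : Code → ℕ
encode Zc         = ⟪ 0 , 0 ⟫
encode Sc         = ⟪ 1 , 0 ⟫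
encode Ic         = ⟪ 2 , 0 ⟫
encode Lc         = ⟪ 3 , 0 ⟫
encode Rc         = ⟪ 4 , 0 ⟫
encode (Pc f g)   = ⟪ 5 , ⟪ encode f , encode g ⟫ ⟫
encode (Cc f g)   = ⟪ 6 , ⟪ encode f , encode g ⟫ ⟫
encode (Recc f g) = ⟪ 7 , ⟪ encode f , encode g ⟫ ⟫
encode (Muc f)    = ⟪ 8 , encode f ⟫

-- The case split of `decode′` with the tag as an argument, so that rewriting the tag selects the
-- branch even for an opaque pair.
decodeTag : ℕ → ℕ → ℕ → Code
decodeTag k 0 r = Zc
decodeTag k 1 r = Sc
decodeTag k 2 r = Ic
decodeTag k 3 r = Lc
decodeTag k 4 r = Rc
decodeTag k 5 r = Pc (decode′ k (π₁ r)) (decode′ k (π₂ r))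
decodeTag k 6 r = Cc (decode′ k (π₁ r)) (decode′ k (π₂ r))
decodeTag k 7 r = Recc (decode′ k (π₁ r)) (decode′ k (π₂ r))
decodeTag k 8 r = Muc (decode′ k r)
decodeTag k _ r = Zc

opaque
  unfolding π₁

  decode′-suc : ∀ k e → decode′ (suc k) e ≡ decodeTag k (π₁ e) (π₂ e)
  decode′-suc k e with unpair e
  ... | 0 , r = refl
  ... | 1 , r = refl
  ... | 2 , r = refl
  ... | 3 , r = refl
  ... | 4 , r = refl
  ... | 5 , r = refl
  ... | 6 , r = refl
  ... | 7 , r = refl
  ... | 8 , r = refl
  ... | suc (suc (suc (suc (suc (suc (suc (suc (suc _)))))))) , r = refl

decode′-pair : ∀ k t r → decode′ (suc k) ⟪ t , r ⟫ ≡ decodeTag k t r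
decode′-pair k t r = trans (decode′-suc k ⟪ t , r ⟫) (cong₂ (decodeTag k) (β₁ t r) (β₂ t r))

module _ {k} (t f g : ℕ) (le : ⟪ suc t , ⟪ f , g ⟫ ⟫ ≤ suc k) where
  private
    inner : ⟪ f , g ⟫ ≤ k
    inner = s≤s⁻¹ (≤-trans (<-pairʳ t ⟪ f , g ⟫) le)

  fuelˡ : f ≤ k
  fuelˡ = ≤-trans (≤-pairˡ f g) inner

  fuelʳ : g ≤ k
  fuelʳ = ≤-trans (≤-pairʳ f g) inner

-- Each component is strictly below the number of the whole, because compound codes have positive
-- tags; so one unit of fuel can be spent per level. Without fuel only `Zc` is possible.
decode′-encode : ∀ c k → encode c ≤ k → decode′ k (encode c) ≡ c
decode′-encode Zc zero _ = refl
decode′-encode Zc (suc k) _ = decode′-pair k 0 0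
decode′-encode Sc (suc k) _ = decode′-pair k 1 0
decode′-encode Ic (suc k) _ = decode′-pair k 2 0
decode′-encode Lc (suc k) _ = decode′-pair k 3 0
decode′-encode Rc (suc k) _ = decode′-pair k 4 0
decode′-encode (Pc f g) (suc k) le
  rewrite decode′-pair k 5 ⟪ encode f , encode g ⟫ | β₁ (encode f) (encode g) | β₂ (encode f) (encode g)
  = cong₂ Pc (decode′-encode f k (fuelˡ 4 _ _ le)) (decode′-encode g k (fuelʳ 4 _ _ le))
decode′-encode (Cc f g) (suc k) le
  rewrite decode′-pair k 6 ⟪ encode f , encode g ⟫ | β₁ (encode f) (encode g) | β₂ (encode f) (encode g)
  = cong₂ Cc (decode′-encode f k (fuelˡ 5 _ _ le)) (decode′-encode g k (fuelʳ 5 _ _ le))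
decode′-encode (Recc f g) (suc k) le
  rewrite decode′-pair k 7 ⟪ encode f , encode g ⟫ | β₁ (encode f) (encode g) | β₂ (encode f) (encode g)
  = cong₂ Recc (decode′-encode f k (fuelˡ 6 _ _ le)) (decode′-encode g k (fuelʳ 6 _ _ le))
decode′-encode (Muc f) (suc k) le
  rewrite decode′-pair k 8 (encode f)
  = cong Muc (decode′-encode f k (s≤s⁻¹ (≤-trans (<-pairʳ 7 (encode f)) le)))
decode′-encode Sc zero le = ⊥-elim (n≮0 (≤-trans (<-pairʳ 0 _) le))
decode′-encode Ic zero le = ⊥-elim (n≮0 (≤-trans (<-pairʳ 1 _) le))
decode′-encode Lc zero le = ⊥-elim (n≮0 (≤-trans (<-pairʳ 2 _) le))
decode′-encode Rc zero le = ⊥-elim (n≮0 (≤-trans (<-pairʳ 3 _) le))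
decode′-encode (Pc f g) zero le = ⊥-elim (n≮0 (≤-trans (<-pairʳ 4 _) le))
decode′-encode (Cc f g) zero le = ⊥-elim (n≮0 (≤-trans (<-pairʳ 5 _) le))
decode′-encode (Recc f g) zero le = ⊥-elim (n≮0 (≤-trans (<-pairʳ 6 _) le))
decode′-encode (Muc f) zero le = ⊥-elim (n≮0 (≤-trans (<-pairʳ 7 _) le))

decode-encode : ∀ c → decode (encode c) ≡ c
decode-encode c = decode′-encode c (encode c) ≤-refl

-- A calculus of programs.

-- A program for the input-output family (i a ↦ o a)ₐ. The index type may carry
-- hypotheses, such as the totality of φₑ, that are needed for convergence but
-- on which the code does not depend.
record Fn {I : Set} (i o : I → ℕ) : Set where
  constructor fn
  field
    code : Code
    run  : ∀ a → Eval code (i a) (o a)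

open Fn

module _ {I : Set} {i : I → ℕ} where

  inputF : Fn i i
  inputF = fn Ic λ _ → evI

  castF : {o o′ : I → ℕ} → (∀ a → o a ≡ o′ a) → Fn i o → Fn i o′
  castF eq f = fn (code f) λ a → subst (Eval (code f) (i a)) (eq a) (run f a)

  onF : {J : Set} {j o : J → ℕ} (m : I → J) → Fn j o → Fn i (λ a → j (m a)) → Fn i (λ a → o (m a))
  onF m f g = fn (Cc (code f) (code g)) λ a → evC (run g a) (run f (m a))

  sucF : {u : I → ℕ} → Fn i u → Fn i (λ a → suc (u a))
  sucF f = fn (Cc Sc (code f)) λ a → evC (run f a) evS

opaque
  unfolding ⟪_,_⟫

  pairF : {I : Set} {i u v : I → ℕ} → Fn i u → Fn i v → Fn i (λ a → ⟪ u a , v a ⟫)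
  pairF f g = fn (Pc (code f) (code g)) λ a → evP (run f a) (run g a)

  π₁F : {I : Set} {i u : I → ℕ} → Fn i u → Fn i (λ a → π₁ (u a))
  π₁F f = fn (Cc Lc (code f)) λ a → evC (run f a) evL

  π₂F : {I : Set} {i u : I → ℕ} → Fn i u → Fn i (λ a → π₂ (u a))
  π₂F f = fn (Cc Rc (code f)) λ a → evC (run f a) evR

  recF : {I : Set} {i : I → ℕ} (r : I → ℕ → ℕ) → Fn i (λ a → r a 0) →
         Fn {I × ℕ} (λ (a , n) → ⟪ i a , ⟪ n , r a n ⟫ ⟫) (λ (a , n) → r a (suc n)) →
         Fn {I × ℕ} (λ (a , n) → ⟪ i a , n ⟫) (λ (a , n) → r a n)
  recF {I} {i} r f g = fn (Recc (code f) (code g)) λ (a , n) →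
    evRec (subst₂ (λ x m → EvalRec (code f) (code g) x m (r a n))
                  (sym (β₁ (i a) n)) (sym (β₂ (i a) n)) (unroll a n))
    where
    unroll : ∀ a n → EvalRec (code f) (code g) (i a) n (r a n)
    unroll a zero    = recZ (run f a)
    unroll a (suc n) = recS (unroll a n) (run g (a , n))

  -- The result `o` is supplied together with its minimality, and may depend on a proof of
  -- convergence carried by the index.
  minF : {I : Set} {i : I → ℕ} (g : I × ℕ → ℕ) (o : I → ℕ) →
         Fn (λ (a , n) → ⟪ i a , n ⟫) g → (∀ a → g (a , o a) ≡ 0) →
         (∀ a m → m < o a → ∃[ k ] g (a , m) ≡ suc k) → Fn i o
  minF g o f zero-at pos-below = fn (Muc (code f)) λ a →
    evMu (subst (Eval _ _) (zero-at a) (run f (a , o a)))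
         (λ m m<o → proj₁ (pos-below a m m<o) , subst (Eval _ _) (proj₂ (pos-below a m m<o)) (run f (a , m)))

fstF : {I : Set} {i u v : I → ℕ} → Fn i (λ a → ⟪ u a , v a ⟫) → Fn i u
fstF {u = u} {v} f = castF (λ a → β₁ (u a) (v a)) (π₁F f)

sndF : {I : Set} {i u v : I → ℕ} → Fn i (λ a → ⟪ u a , v a ⟫) → Fn i v
sndF {u = u} {v} f = castF (λ a → β₂ (u a) (v a)) (π₂F f)

-- Arithmetic and Boolean tests.

bit : Bool → ℕ
bit b = if b then 1 else 0

Fn₁ : (ℕ → ℕ) → Set
Fn₁ f = Fn (λ n → n) f

Fn₂ : (ℕ → ℕ → ℕ) → Set
Fn₂ f = Fn {ℕ × ℕ} (λ (m , n) → ⟪ m , n ⟫) (λ (m , n) → f m n)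

Pred : {I : Set} → (I → ℕ) → (I → Bool) → Set
Pred i p = Fn i (λ a → bit (p a))

module _ {I : Set} {i : I → ℕ} where

  app₁ : {f : ℕ → ℕ} {u : I → ℕ} → Fn₁ f → Fn i u → Fn i (λ a → f (u a))
  app₁ {u = u} f g = onF u f g

  app₂ : {f : ℕ → ℕ → ℕ} {u v : I → ℕ} → Fn₂ f → Fn i u → Fn i v → Fn i (λ a → f (u a) (v a))
  app₂ {u = u} {v} f g h = onF (λ a → u a , v a) f (pairF g h)

  constF : (n : ℕ) → Fn i (λ _ → n)
  constF zero    = fn Zc λ _ → evZ
  constF (suc n) = sucF (constF n)

iterF : {z : ℕ} (r : ℕ → ℕ) → r 0 ≡ z → Fn {ℕ} (λ n → ⟪ n , r n ⟫) (λ n → r (suc n)) → Fn₁ r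
iterF {z = z} r eq g =
  -- Recursion needs a parameter: a dummy 0, which the step discards.
  onF (λ n → 0 , n)
      (recF {i = λ n → n} (λ _ → r) (castF (λ _ → sym eq) (constF z)) (onF proj₂ g (sndF inputF)))
      (pairF (constF 0) inputF)

predF : Fn₁ pred
predF = iterF pred refl (fstF inputF)

addF : Fn₂ _+_
addF = castF (λ (m , n) → +-comm n m) (recF (λ m n → n + m) inputF (sucF (sndF (sndF inputF))))

monusF : Fn₂ _∸_
monusF = recF _∸_ inputF (castF (λ (m , n) → pred[m∸n]≡m∸[1+n] m n) (app₁ predF (sndF (sndF inputF))))

mulF : Fn₂ _*_
mulF = castF (λ (m , n) → *-comm n m)
  (recF (λ m n → n * m) (constF 0) (app₂ addF (fstF inputF) (sndF (sndF inputF))))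

2^F : Fn₁ (2 ^_)
2^F = iterF (2 ^_) refl (app₂ mulF (constF 2) (sndF inputF))

ifZero : ℕ → ℕ → ℕ → ℕ
ifZero zero    x y = x
ifZero (suc _) x y = y

-- One of the two truncated differences is 0, so their sum is the distance of `m` and `n`.
bit-≡ᵇ : ∀ m n → 1 ∸ ((m ∸ n) + (n ∸ m)) ≡ bit (m ≡ᵇ n)
bit-≡ᵇ zero    zero    = refl
bit-≡ᵇ zero    (suc n) = 0∸n≡0 n
bit-≡ᵇ (suc m) zero    = 0∸n≡0 (m + 0)
bit-≡ᵇ (suc m) (suc n) = bit-≡ᵇ m n

module _ {I : Set} {i : I → ℕ} where

  -- Both branches are run whatever the test says, so both must converge; a recursion of at most one
  -- step then selects a result.
  ifF : {p : I → Bool} {u v : I → ℕ} → Pred i p → Fn i u → Fn i v → Fn i (λ a → if p a then u a else v a)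
  ifF {p} {u} {v} f g h = castF (λ a → choose (p a) (u a) (v a))
    (onF (λ a → (u a , v a) , bit (p a))
         (recF (λ (x , y) n → ifZero n y x) (sndF inputF) (fstF (fstF inputF)))
         (pairF (pairF g h) f))
    where
    choose : ∀ b x y → ifZero (bit b) y x ≡ (if b then x else y)
    choose true  x y = refl
    choose false x y = refl

  notF : {p : I → Bool} → Pred i p → Pred i (λ a → not (p a))
  notF {p} f = castF (λ a → eq (p a)) (ifF f (constF 0) (constF 1))
    where
    eq : ∀ b → (if b then 0 else 1) ≡ bit (not b)
    eq true  = refl
    eq false = refl

  andF : {p q : I → Bool} → Pred i p → Pred i q → Pred i (λ a → p a ∧ q a)
  andF {p} {q} f g = castF (λ a → eq (p a) (q a)) (ifF f g (constF 0))
    where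
    eq : ∀ b c → (if b then bit c else 0) ≡ bit (b ∧ c)
    eq true  c = refl
    eq false c = refl

  orF : {p q : I → Bool} → Pred i p → Pred i q → Pred i (λ a → p a ∨ q a)
  orF {p} {q} f g = castF (λ a → eq (p a) (q a)) (ifF f (constF 1) g)
    where
    eq : ∀ b c → (if b then 1 else bit c) ≡ bit (b ∨ c)
    eq true  c = refl
    eq false c = refl

  ≡ᵇF : {u v : I → ℕ} → Fn i u → Fn i v → Pred i (λ a → u a ≡ᵇ v a)
  ≡ᵇF {u} {v} f g = castF (λ a → bit-≡ᵇ (u a) (v a))
    (app₂ monusF (constF 1) (app₂ addF (app₂ monusF f g) (app₂ monusF g f)))

-- Binary digits.

odd-suc : ∀ n → odd (suc n) ≡ not (odd n)
odd-suc zero          = refl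
odd-suc (suc zero)    = refl
odd-suc (suc (suc n)) = odd-suc n

oddF : Fn₁ (λ n → bit (odd n))
oddF = iterF (λ n → bit (odd n)) refl (castF (λ n → cong bit (sym (odd-suc n))) (notF {p = odd} (sndF inputF)))

half-suc : ∀ n → half n + bit (odd n) ≡ half (suc n)
half-suc zero          = refl
half-suc (suc zero)    = refl
half-suc (suc (suc n)) = cong suc (half-suc n)

halfF : Fn₁ half
halfF = iterF half refl (castF half-suc (app₂ addF (sndF inputF) (app₁ oddF (fstF inputF))))

-- `testBit` changes its second argument as it recurses, whereas `recF` keeps a fixed parameter;
-- halving repeatedly and reading the last digit avoids this.
shift : ℕ → ℕ → ℕ
shift c zero    = c
shift c (suc n) = half (shift c n)

odd-shift : ∀ c n → odd (shift c n) ≡ testBit n c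
odd-shift c zero    = refl
odd-shift c (suc n) = trans (cong odd (shift-half n)) (odd-shift (half c) n)
  where
  shift-half : ∀ n → half (shift c n) ≡ shift (half c) n
  shift-half zero    = refl
  shift-half (suc n) = cong half (shift-half n)

testBitF : Fn {ℕ × ℕ} (λ (c , n) → ⟪ c , n ⟫) (λ (c , n) → bit (testBit n c))
testBitF = castF (λ (c , n) → cong bit (odd-shift c n))
  (onF (λ (c , n) → shift c n) oddF (recF shift inputF (app₁ halfF (sndF (sndF inputF)))))

-- The parameter (s-m-n) theorem.

numeral : ℕ → Code
numeral zero    = Zc
numeral (suc n) = Cc Sc (numeral n)

Eval-numeral : ∀ n x → Eval (numeral n) x n
Eval-numeral zero    x = evZ
Eval-numeral (suc n) x = evC (Eval-numeral n x) evS

specialize : Code → ℕ → Code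
specialize c n = Cc c (Pc (numeral n) Ic)

opaque
  unfolding ⟪_,_⟫

  Eval-specialize : ∀ {c n x y} → Eval c ⟪ n , x ⟫ y → Eval (specialize c n) x y
  Eval-specialize d = evC (evP (Eval-numeral _ _) evI) d

encode-numeralF : Fn₁ (λ n → encode (numeral n))
encode-numeralF = iterF (λ n → encode (numeral n)) refl
  -- 6 is the tag of `Cc`; the 5 below is that of `Pc`.
  (pairF (constF 6) (pairF (constF (encode Sc)) (sndF inputF)))

encode-specializeF : ∀ {I i u} (c : Code) → Fn {I} i u → Fn i (λ a → encode (specialize c (u a)))
encode-specializeF c f =
  pairF (constF 6) (pairF (constF (encode c))
    (pairF (constF 5) (pairF (app₁ encode-numeralF f) (constF (encode Ic)))))

-- A universal program: a machine whose state ⟪ v , K ⟫ consists of a value v and a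
-- stack K of pending instructions; the stack is 0 when empty, so the machine
-- has halted with result v once π₂ of the state is 0.

push : ℕ → ℕ → ℕ → ℕ
push t a K = suc ⟪ ⟪ t , a ⟫ , K ⟫

-- v ↦ the value of decode′ k e at v
pushEval : ℕ → ℕ → ℕ → ℕ
pushEval k e K = push 0 ⟪ k , e ⟫ K

-- v ↦ ⟪ a , v ⟫
pushPrepend : ℕ → ℕ → ℕ
pushPrepend a K = push 1 a K

-- v ↦ ⟪ v , value of decode′ k e at x ⟫
pushSecond : ℕ → ℕ → ℕ → ℕ → ℕ
pushSecond x k e K = push 2 ⟪ x , ⟪ k , e ⟫ ⟫ K

-- v is the value at ⟪ x , m ⟫ of decode′ k e, whose least zero from m on is sought
pushMin : ℕ → ℕ → ℕ → ℕ → ℕ → ℕ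
pushMin k e x m K = push 3 ⟪ ⟪ k , e ⟫ , ⟪ x , m ⟫ ⟫ K

recStep : ℕ → ℕ → ℕ → ℕ → ℕ → ℕ
recStep x n k e K =
  if n ≡ᵇ 0 then ⟪ x , pushEval k (π₁ (π₂ e)) K ⟫
  -- The same program is run at `pred n`, with fuel restored to `suc k`; its value `y` is then
  -- wrapped into `⟪ x , ⟪ pred n , y ⟫ ⟫` for the step program.
  else ⟪ ⟪ x , pred n ⟫ , pushEval (suc k) e (pushPrepend (pred n) (pushPrepend x (pushEval k (π₂ (π₂ e)) K))) ⟫

tagStep : ℕ → ℕ → ℕ → ℕ → ℕ → ℕ
tagStep v k e t K =
  if t ≡ᵇ 1 then ⟪ suc v , K ⟫ else
  if t ≡ᵇ 2 then ⟪ v , K ⟫ else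
  if t ≡ᵇ 3 then ⟪ π₁ v , K ⟫ else
  if t ≡ᵇ 4 then ⟪ π₂ v , K ⟫ else
  if t ≡ᵇ 5 then ⟪ v , pushEval k (π₁ (π₂ e)) (pushSecond v k (π₂ (π₂ e)) K) ⟫ else
  if t ≡ᵇ 6 then ⟪ v , pushEval k (π₂ (π₂ e)) (pushEval k (π₁ (π₂ e)) K) ⟫ else
  if t ≡ᵇ 7 then recStep (π₁ v) (π₂ v) k e K else
  if t ≡ᵇ 8 then ⟪ ⟪ v , 0 ⟫ , pushEval k (π₂ e) (pushMin k (π₂ e) v 0 K) ⟫ else
  -- Tag 0 and all tags above 8 decode to `Zc`.
  ⟪ 0 , K ⟫

evalStep : ℕ → ℕ → ℕ → ℕ → ℕ
evalStep v k e K = if k ≡ᵇ 0 then ⟪ 0 , K ⟫ else tagStep v (pred k) e (π₁ e) K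

minStep : ℕ → ℕ → ℕ → ℕ → ℕ → ℕ → ℕ
minStep v k e x m K =
  if v ≡ᵇ 0 then ⟪ m , K ⟫ else ⟪ ⟪ x , suc m ⟫ , pushEval k e (pushMin k e x (suc m) K) ⟫

dispatch : ℕ → ℕ → ℕ → ℕ → ℕ
dispatch v t a K =
  if t ≡ᵇ 0 then evalStep v (π₁ a) (π₂ a) K else
  if t ≡ᵇ 1 then ⟪ ⟪ a , v ⟫ , K ⟫ else
  if t ≡ᵇ 2 then ⟪ π₁ a , pushEval (π₁ (π₂ a)) (π₂ (π₂ a)) (pushPrepend v K) ⟫ else
  minStep v (π₁ (π₁ a)) (π₂ (π₁ a)) (π₁ (π₂ a)) (π₂ (π₂ a)) K

step : ℕ → ℕ
step s = dispatch (π₁ s) (π₁ (π₁ K)) (π₂ (π₁ K)) (π₂ K)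
  where
  K = pred (π₂ s)

-- The step function as a program.

module _ {I : Set} {i : I → ℕ} where

  pushF : ∀ {t a K} → Fn i t → Fn i a → Fn i K → Fn i (λ j → push (t j) (a j) (K j))
  pushF t a K = sucF (pairF (pairF t a) K)

  pushEvalF : ∀ {k e K} → Fn i k → Fn i e → Fn i K → Fn i (λ j → pushEval (k j) (e j) (K j))
  pushEvalF k e K = pushF (constF 0) (pairF k e) K

  pushPrependF : ∀ {a K} → Fn i a → Fn i K → Fn i (λ j → pushPrepend (a j) (K j))
  pushPrependF a K = pushF (constF 1) a K

  pushSecondF : ∀ {x k e K} → Fn i x → Fn i k → Fn i e → Fn i K →
                Fn i (λ j → pushSecond (x j) (k j) (e j) (K j))
  pushSecondF x k e K = pushF (constF 2) (pairF x (pairF k e)) K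

  pushMinF : ∀ {k e x m K} → Fn i k → Fn i e → Fn i x → Fn i m → Fn i K →
             Fn i (λ j → pushMin (k j) (e j) (x j) (m j) (K j))
  pushMinF k e x m K = pushF (constF 3) (pairF (pairF k e) (pairF x m)) K

  recStepF : ∀ {x n k e K} → Fn i x → Fn i n → Fn i k → Fn i e → Fn i K →
             Fn i (λ j → recStep (x j) (n j) (k j) (e j) (K j))
  recStepF x n k e K =
    ifF (≡ᵇF n (constF 0)) (pairF x (pushEvalF k (π₁F (π₂F e)) K))
      (pairF (pairF x (app₁ predF n))
             (pushEvalF (sucF k) e
               (pushPrependF (app₁ predF n) (pushPrependF x (pushEvalF k (π₂F (π₂F e)) K)))))

  tagStepF : ∀ {v k e t K} → Fn i v → Fn i k → Fn i e → Fn i t → Fn i K →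
             Fn i (λ j → tagStep (v j) (k j) (e j) (t j) (K j))
  tagStepF v k e t K =
    ifF (≡ᵇF t (constF 1)) (pairF (sucF v) K) (
    ifF (≡ᵇF t (constF 2)) (pairF v K) (
    ifF (≡ᵇF t (constF 3)) (pairF (π₁F v) K) (
    ifF (≡ᵇF t (constF 4)) (pairF (π₂F v) K) (
    ifF (≡ᵇF t (constF 5)) (pairF v (pushEvalF k (π₁F (π₂F e)) (pushSecondF v k (π₂F (π₂F e)) K))) (
    ifF (≡ᵇF t (constF 6)) (pairF v (pushEvalF k (π₂F (π₂F e)) (pushEvalF k (π₁F (π₂F e)) K))) (
    ifF (≡ᵇF t (constF 7)) (recStepF (π₁F v) (π₂F v) k e K) (
    ifF (≡ᵇF t (constF 8)) (pairF (pairF v (constF 0)) (pushEvalF k (π₂F e) (pushMinF k (π₂F e) v (constF 0) K)))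
    (pairF (constF 0) K))))))))

  evalStepF : ∀ {v k e K} → Fn i v → Fn i k → Fn i e → Fn i K →
              Fn i (λ j → evalStep (v j) (k j) (e j) (K j))
  evalStepF v k e K =
    ifF (≡ᵇF k (constF 0)) (pairF (constF 0) K) (tagStepF v (app₁ predF k) e (π₁F e) K)

  minStepF : ∀ {v k e x m K} → Fn i v → Fn i k → Fn i e → Fn i x → Fn i m → Fn i K →
             Fn i (λ j → minStep (v j) (k j) (e j) (x j) (m j) (K j))
  minStepF v k e x m K =
    ifF (≡ᵇF v (constF 0)) (pairF m K)
        (pairF (pairF x (sucF m)) (pushEvalF k e (pushMinF k e x (sucF m) K)))

  dispatchF : ∀ {v t a K} → Fn i v → Fn i t → Fn i a → Fn i K →
              Fn i (λ j → dispatch (v j) (t j) (a j) (K j))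
  dispatchF v t a K =
    ifF (≡ᵇF t (constF 0)) (evalStepF v (π₁F a) (π₂F a) K) (
    ifF (≡ᵇF t (constF 1)) (pairF (pairF a v) K) (
    ifF (≡ᵇF t (constF 2)) (pairF (π₁F a) (pushEvalF (π₁F (π₂F a)) (π₂F (π₂F a)) (pushPrependF v K)))
    (minStepF v (π₁F (π₁F a)) (π₂F (π₁F a)) (π₁F (π₂F a)) (π₂F (π₂F a)) K)))

stepF : Fn₁ step
stepF = dispatchF (π₁F inputF) (π₁F (π₁F K)) (π₂F (π₁F K)) (π₂F K)
  where
  K = app₁ predF (π₂F inputF)

iterate : ℕ → ℕ → ℕ
iterate s zero    = s
iterate s (suc n) = step (iterate s n)

iterateF : Fn₂ iterate
iterateF = recF iterate inputF (app₁ stepF (sndF (sndF inputF)))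

-- Runs of the machine.

infix 4 _↝_
-- Only states with pending instructions may be left, so the length of a path to an empty stack is
-- the least halting time, as minimisation requires.
data _↝_ : ℕ → ℕ → Set where
  halt : ∀ {s} → s ↝ s
  next : ∀ {s s′ j} → π₂ s ≡ suc j → step s ↝ s′ → s ↝ s′

↝-trans : ∀ {s s′ s″} → s ↝ s′ → s′ ↝ s″ → s ↝ s″
↝-trans halt       q = q
↝-trans (next b p) q = next b (↝-trans p q)

steps : ∀ {s s′} → s ↝ s′ → ℕ
steps halt       = 0
steps (next _ p) = suc (steps p)

iterate-step : ∀ s n → iterate (step s) n ≡ iterate s (suc n)
iterate-step s zero    = refl
iterate-step s (suc n) = cong step (iterate-step s n)

iterate-steps : ∀ {s s′} (p : s ↝ s′) → iterate s (steps p) ≡ s′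
iterate-steps halt           = refl
iterate-steps {s} (next _ p) = trans (sym (iterate-step s (steps p))) (iterate-steps p)

busy-below-steps : ∀ {s s′} (p : s ↝ s′) m → m < steps p → ∃[ k ] π₂ (iterate s m) ≡ suc k
busy-below-steps (next b p) zero    _ = _ , b
busy-below-steps {s} (next b p) (suc m) (s≤s m<)
  with k , eq ← busy-below-steps p m m< = k , trans (cong π₂ (sym (iterate-step s m))) eq

-- Minimisation finds the first time at which the stack is empty; a second run of that length yields
-- the value.
runMachineF : Fn {Σ ℕ λ s → Σ ℕ λ y → s ↝ ⟪ y , 0 ⟫} proj₁ (λ (_ , y , _) → y)
runMachineF = castF (λ (s , y , p) → trans (cong π₁ (iterate-steps p)) (β₁ y 0))
  (π₁F (onF (λ (s , _ , p) → s , steps p) iterateF (pairF inputF halting-time)))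
  where
  halting-time : Fn {Σ ℕ λ s → Σ ℕ λ y → s ↝ ⟪ y , 0 ⟫} proj₁ (λ (_ , _ , p) → steps p)
  halting-time = minF (λ ((s , _) , n) → π₂ (iterate s n)) (λ (_ , _ , p) → steps p)
    (π₂F (onF (λ ((s , _) , n) → s , n) iterateF inputF))
    (λ (s , y , p) → trans (cong π₂ (iterate-steps p)) (β₂ y 0))
    (λ (s , y , p) → busy-below-steps p)

-- Correctness of the machine.

next-push : ∀ v t a K {s} → dispatch v t a K ↝ s → ⟪ v , push t a K ⟫ ↝ s
next-push v t a K {s} p = next (β₂ v _) (subst (_↝ s) (sym eq) p)
  where
  eq : step ⟪ v , push t a K ⟫ ≡ dispatch v t a K
  eq rewrite β₁ v (push t a K) | β₂ v (push t a K) | β₁ ⟪ t , a ⟫ K | β₂ ⟪ t , a ⟫ K | β₁ t a | β₂ t a = refl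

next-eval : ∀ v k e K {s} → evalStep v k e K ↝ s → ⟪ v , pushEval k e K ⟫ ↝ s
next-eval v k e K {s} p = next-push v 0 ⟪ k , e ⟫ K
  (subst₂ (λ k e → evalStep v k e K ↝ s) (sym (β₁ k e)) (sym (β₂ k e)) p)

next-tag : ∀ v k e {t} K {s} → π₁ e ≡ t → tagStep v k e t K ↝ s → ⟪ v , pushEval (suc k) e K ⟫ ↝ s
next-tag v k e K refl p = next-eval v (suc k) e K p

next-prepend : ∀ v a K {s} → ⟪ ⟪ a , v ⟫ , K ⟫ ↝ s → ⟪ v , pushPrepend a K ⟫ ↝ s
next-prepend v a K p = next-push v 1 a K p

next-second : ∀ v x k e K {s} → ⟪ x , pushEval k e (pushPrepend v K) ⟫ ↝ s → ⟪ v , pushSecond x k e K ⟫ ↝ s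
next-second v x k e K {s} p = next-push v 2 _ K (subst (_↝ s) (sym eq) p)
  where
  eq : dispatch v 2 ⟪ x , ⟪ k , e ⟫ ⟫ K ≡ ⟪ x , pushEval k e (pushPrepend v K) ⟫
  eq rewrite β₁ x ⟪ k , e ⟫ | β₂ x ⟪ k , e ⟫ | β₁ k e | β₂ k e = refl

next-min : ∀ v k e x m K {s} → minStep v k e x m K ↝ s → ⟪ v , pushMin k e x m K ⟫ ↝ s
next-min v k e x m K {s} p = next-push v 3 _ K (subst (_↝ s) (sym eq) p)
  where
  eq : dispatch v 3 ⟪ ⟪ k , e ⟫ , ⟪ x , m ⟫ ⟫ K ≡ minStep v k e x m K
  eq rewrite β₁ ⟪ k , e ⟫ ⟪ x , m ⟫ | β₂ ⟪ k , e ⟫ ⟪ x , m ⟫ | β₁ k e | β₂ k e | β₁ x m | β₂ x m = refl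

-- Quantifying over the stack `K` underneath makes runs of subprograms compose.
record Runs (k e x y : ℕ) : Set where
  constructor runs
  field
    path : ∀ K → ⟪ x , pushEval k e K ⟫ ↝ ⟪ y , K ⟫

open Runs

-- The graph of `decode′` as a family, to be matched alongside an `Eval` derivation. `dZ` serves tag
-- 0 and the tags above 8 alike.
data Decoded : ℕ → ℕ → Code → Set where
  dNoFuel : ∀ {e} → Decoded 0 e Zc
  dZ : ∀ {k e} → (∀ v K → tagStep v k e (π₁ e) K ≡ ⟪ 0 , K ⟫) → Decoded (suc k) e Zc
  dS : ∀ {k e} → π₁ e ≡ 1 → Decoded (suc k) e Sc
  dI : ∀ {k e} → π₁ e ≡ 2 → Decoded (suc k) e Ic
  dL : ∀ {k e} → π₁ e ≡ 3 → Decoded (suc k) e Lc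
  dR : ∀ {k e} → π₁ e ≡ 4 → Decoded (suc k) e Rc
  dP : ∀ {k e f g} → π₁ e ≡ 5 → Decoded k (π₁ (π₂ e)) f → Decoded k (π₂ (π₂ e)) g → Decoded (suc k) e (Pc f g)
  dC : ∀ {k e f g} → π₁ e ≡ 6 → Decoded k (π₁ (π₂ e)) f → Decoded k (π₂ (π₂ e)) g → Decoded (suc k) e (Cc f g)
  dRec : ∀ {k e f g} → π₁ e ≡ 7 → Decoded k (π₁ (π₂ e)) f → Decoded k (π₂ (π₂ e)) g → Decoded (suc k) e (Recc f g)
  dMu : ∀ {k e f} → π₁ e ≡ 8 → Decoded k (π₂ e) f → Decoded (suc k) e (Muc f)

decoded : ∀ k e → Decoded k e (decode′ k e)
decoded zero    e = dNoFuel
decoded (suc k) e = subst (Decoded (suc k) e) (sym (decode′-suc k e)) (byTag (π₁ e) refl)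
  where
  byTag : ∀ t → π₁ e ≡ t → Decoded (suc k) e (decodeTag k t (π₂ e))
  byTag 0 eq = dZ λ v K → cong (λ t → tagStep v k e t K) eq
  byTag 1 eq = dS eq
  byTag 2 eq = dI eq
  byTag 3 eq = dL eq
  byTag 4 eq = dR eq
  byTag 5 eq = dP eq (decoded k _) (decoded k _)
  byTag 6 eq = dC eq (decoded k _) (decoded k _)
  byTag 7 eq = dRec eq (decoded k _) (decoded k _)
  byTag 8 eq = dMu eq (decoded k _)
  byTag (suc (suc (suc (suc (suc (suc (suc (suc (suc _))))))))) eq =
    dZ λ v K → cong (λ t → tagStep v k e t K) eq

module _ {k e : ℕ} where

  runs-P : ∀ {x a b} → π₁ e ≡ 5 → Runs k (π₁ (π₂ e)) x a → Runs k (π₂ (π₂ e)) x b → Runs (suc k) e x ⟪ a , b ⟫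
  runs-P {x} {a} {b} eq p q = runs λ K → next-tag x k e K eq
    (↝-trans (path p _) (next-second a x k _ K (↝-trans (path q _) (next-prepend b a K halt))))

  runs-C : ∀ {x y z} → π₁ e ≡ 6 → Runs k (π₂ (π₂ e)) x y → Runs k (π₁ (π₂ e)) y z → Runs (suc k) e x z
  runs-C {x} eq p q = runs λ K → next-tag x k e K eq (↝-trans (path p _) (path q K))

  runs-recZ : ∀ {w x y} → π₁ e ≡ 7 → π₁ w ≡ x → π₂ w ≡ 0 → Runs k (π₁ (π₂ e)) x y → Runs (suc k) e w y
  runs-recZ {w} {y = y} eq refl w₂ p = runs λ K → next-tag w k e K eq
    (subst (λ n → recStep (π₁ w) n k e K ↝ ⟪ y , K ⟫) (sym w₂) (path p K))

  runs-recS : ∀ {w x n y z} → π₁ e ≡ 7 → π₁ w ≡ x → π₂ w ≡ suc n →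
              Runs (suc k) e ⟪ x , n ⟫ y → Runs k (π₂ (π₂ e)) ⟪ x , ⟪ n , y ⟫ ⟫ z → Runs (suc k) e w z
  runs-recS {w} {x} {n} {y} {z} eq refl w₂ p q = runs λ K → next-tag w k e K eq
    (subst (λ n → recStep (π₁ w) n k e K ↝ ⟪ z , K ⟫) (sym w₂)
      (↝-trans (path p _) (next-prepend y n _ (next-prepend ⟪ n , y ⟫ x _ (path q K)))))

  runs-Mu : ∀ {x n} → π₁ e ≡ 8 → Runs k (π₂ e) ⟪ x , n ⟫ 0 →
            (∀ m → m < n → ∃[ j ] Runs k (π₂ e) ⟪ x , m ⟫ (suc j)) → Runs (suc k) e x n
  runs-Mu {x} {n} eq p below = runs λ K → next-tag x k e K eq (search K n 0 refl)
    where
    -- `d` counts the candidates left before the least zero `n`.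
    search : ∀ K d m → m + d ≡ n → ⟪ ⟪ x , m ⟫ , pushEval k (π₂ e) (pushMin k (π₂ e) x m K) ⟫ ↝ ⟪ n , K ⟫
    search K zero m refl rewrite +-identityʳ m =
      ↝-trans (path p _) (next-min 0 k (π₂ e) x m K halt)
    search K (suc d) m refl with j , q ← below m (m<m+n m (s≤s z≤n)) =
      ↝-trans (path q _) (next-min (suc j) k (π₂ e) x m K (search K d (suc m) (sym (+-suc m d))))

opaque
  unfolding ⟪_,_⟫

  -- Induction on the derivation. Recursion gets its own induction, since its intermediate values
  -- come from the number `e` itself and not from a component; there `w` is any number with the
  -- right projections.
  simulate : ∀ {k e c x y} → Decoded k e c → Eval c x y → Runs k e x y
  simulateRec : ∀ {k e f g x n y} → π₁ e ≡ 7 → Decoded k (π₁ (π₂ e)) f → Decoded k (π₂ (π₂ e)) g →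
                EvalRec f g x n y → ∀ w → π₁ w ≡ x → π₂ w ≡ n → Runs (suc k) e w y
  simulate {e = e} {x = x} dNoFuel evZ = runs λ K → next-eval x 0 e K halt
  simulate {suc k} {e} {x = x} (dZ eq) evZ = runs λ K →
    next-eval x (suc k) e K (subst (_↝ ⟪ 0 , K ⟫) (sym (eq x K)) halt)
  simulate {suc k} {e} {x = x} (dS eq) evS = runs λ K → next-tag x k e K eq halt
  simulate {suc k} {e} {x = x} (dI eq) evI = runs λ K → next-tag x k e K eq halt
  simulate {suc k} {e} {x = x} (dL eq) evL = runs λ K → next-tag x k e K eq halt
  simulate {suc k} {e} {x = x} (dR eq) evR = runs λ K → next-tag x k e K eq halt
  simulate (dP eq c d) (evP p q) = runs-P eq (simulate c p) (simulate d q)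
  simulate (dC eq c d) (evC p q) = runs-C eq (simulate d p) (simulate c q)
  simulate {x = w} (dRec eq c d) (evRec p) = simulateRec eq c d p w refl refl
  simulate (dMu eq c) (evMu p below) =
    runs-Mu eq (simulate c p) λ m m<n → let (j , q) = below m m<n in j , simulate c q
  simulateRec eq c d (recZ p) w w₁ w₂ = runs-recZ eq w₁ w₂ (simulate c p)
  simulateRec {x = x} eq c d (recS {n = n} p q) w w₁ w₂ =
    runs-recS eq w₁ w₂ (simulateRec eq c d p _ (β₁ x n) (β₂ x n)) (simulate d q)

universalF : Fn {Σ (ℕ × ℕ × ℕ) λ (e , x , y) → φ e x y} (λ ((e , x , _) , _) → ⟪ e , x ⟫) (λ ((_ , _ , y) , _) → y)
-- Fuel and program number coincide, as in `decode`.
universalF = onF (λ ((e , x , y) , d) → ⟪ x , pushEval e e 0 ⟫ , y , path (simulate (decoded e e) d) 0) runMachineF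
  (pairF (sndF inputF) (pushEvalF (fstF inputF) (fstF inputF) (constF 0)))

≡ᵇ-true : ∀ m n → (m ≡ᵇ n) ≡ true → m ≡ n
≡ᵇ-true zero    zero    _  = refl
≡ᵇ-true (suc m) (suc n) eq = cong suc (≡ᵇ-true m n eq)

≡ᵇ-refl : ∀ {m n} → m ≡ n → (m ≡ᵇ n) ≡ true
≡ᵇ-refl {zero}  refl = refl
≡ᵇ-refl {suc m} refl = ≡ᵇ-refl {m} refl

true≢false : ∀ {b} → b ≡ true → b ≡ false → ⊥
true≢false refl ()

-- Canonical codes of finite sets

+-2*-suc : ∀ c k → c + 2 * suc k ≡ suc (suc (c + 2 * k))
+-2*-suc c k rewrite *-suc 2 k | +-suc c (suc (2 * k)) | +-suc c (2 * k) = refl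

odd-+2* : ∀ c k → odd (c + 2 * k) ≡ odd c
odd-+2* c zero    = cong odd (+-identityʳ c)
odd-+2* c (suc k) = trans (cong odd (+-2*-suc c k)) (odd-+2* c k)

half-+2* : ∀ c k → half (c + 2 * k) ≡ half c + k
half-+2* c zero    = trans (cong half (+-identityʳ c)) (sym (+-identityʳ (half c)))
half-+2* c (suc k) = trans (cong half (+-2*-suc c k)) (trans (cong suc (half-+2* c k)) (sym (+-suc (half c) k)))

-- Bit `x` is clear, so the addition produces no carry.
testBit-+2^ : ∀ x y c → testBit x c ≡ false → testBit y (c + 2 ^ x) ≡ testBit y c ∨ (y ≡ᵇ x)
testBit-+2^ zero zero c x∉c rewrite +-comm c 1 | odd-suc c | x∉c = refl
testBit-+2^ zero (suc y) c x∉c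
  rewrite +-comm c 1 | sym (half-suc c) | x∉c | +-identityʳ (half c) = sym (∨-identityʳ _)
testBit-+2^ (suc x) zero    c x∉c rewrite odd-+2* c (2 ^ x) = sym (∨-identityʳ _)
testBit-+2^ (suc x) (suc y) c x∉c rewrite half-+2* c (2 ^ x) = testBit-+2^ x y (half c) x∉c

testBit-zero : ∀ y → testBit y 0 ≡ false
testBit-zero zero    = refl
testBit-zero (suc y) = testBit-zero y

half-≤ : ∀ c → half c ≤ c
half-≤ zero          = z≤n
half-≤ (suc zero)    = z≤n
half-≤ (suc (suc c)) = s≤s (m≤n⇒m≤1+n (half-≤ c))

-- Lets a code serve as the bound when searching the set it codes.
testBit⇒< : ∀ y c → testBit y c ≡ true → y < c
testBit⇒< zero    (suc c)       _  = s≤s z≤n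
testBit⇒< (suc y) zero          eq = ⊥-elim (true≢false eq (testBit-zero y))
testBit⇒< (suc y) (suc zero)    eq = ⊥-elim (true≢false eq (testBit-zero y))
testBit⇒< (suc y) (suc (suc c)) eq =
  s≤s (≤-trans (testBit⇒< y (suc (half c)) eq) (s≤s (half-≤ c)))

insertCode-old : ∀ m y c → testBit y c ≡ true → testBit y (insertCode m c) ≡ true
insertCode-old nothing y c y∈c = y∈c
insertCode-old (just x) y c y∈c with testBit x c in eq
... | true  = y∈c
... | false rewrite testBit-+2^ x y c eq | y∈c = refl

insertCode-new : ∀ x c → testBit x (insertCode (just x) c) ≡ true
insertCode-new x c with testBit x c in eq
... | true  = eq
... | false rewrite testBit-+2^ x x c eq | ≡ᵇ-refl {x} refl = ∨-zeroʳ _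

insertCode⁻ : ∀ m y c → testBit y (insertCode m c) ≡ true → testBit y c ≡ true ⊎ m ≡ just y
insertCode⁻ nothing y c y∈ = inj₁ y∈
insertCode⁻ (just x) y c y∈ with testBit x c in eq
... | true  = inj₁ y∈
... | false rewrite testBit-+2^ x y c eq with testBit y c
...   | true  = inj₁ refl
...   | false = inj₂ (cong just (sym (≡ᵇ-true y x y∈)))

insertCode-present : ∀ x c → testBit x c ≡ true → insertCode (just x) c ≡ c
insertCode-present x c x∈c rewrite x∈c = refl

content-complete : ∀ T {i j y} → j < i → T j ≡ just y → testBit y (contentCode T i) ≡ true
content-complete T {suc i} {j} {y} j<1+i eq with m≤n⇒m<n∨m≡n (s≤s⁻¹ j<1+i)
... | inj₁ j<i  = insertCode-old (T i) y _ (content-complete T j<i eq)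
... | inj₂ refl rewrite eq = insertCode-new y (contentCode T j)

content-sound : ∀ T i {y} → testBit y (contentCode T i) ≡ true → ∃[ j ] (j < i × T j ≡ just y)
content-sound T zero    {y} y∈ = ⊥-elim (true≢false y∈ (testBit-zero y))
content-sound T (suc i) {y} y∈ with insertCode⁻ (T i) y _ y∈
... | inj₂ eq = i , n<1+n i , eq
... | inj₁ y∈′ with j , j<i , eq ← content-sound T i y∈′ = j , m<n⇒m<1+n j<i , eq

content-⊆ : ∀ L {T} → TextFor T L → ∀ i {y} → testBit y (contentCode T i) ≡ true → L y ≡ true
content-⊆ L {T} T-text i {y} y∈ with j , _ , eq ← content-sound T i y∈ = proj₂ (T-text y) (j , eq)

-- The members below `N` are finitely many; one position for each determines `n₀`.
content-exhausts : ∀ L {T} → TextFor T L → ∀ N →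
  ∃[ n₀ ] (∀ y → y < N → L y ≡ true → ∀ n → n₀ ≤ n → testBit y (contentCode T n) ≡ true)
content-exhausts L T-text zero = 0 , λ _ ()
content-exhausts L {T} T-text (suc N) with content-exhausts L T-text N | L N in L-N
... | n₀ , below | true with j , eq ← proj₁ (T-text N) L-N = n₀ ⊔ suc j , found
  where
  found : ∀ y → y < suc N → L y ≡ true → ∀ n → n₀ ⊔ suc j ≤ n → testBit y (contentCode T n) ≡ true
  found y y<1+N y∈ n le with m≤n⇒m<n∨m≡n (s≤s⁻¹ y<1+N)
  ... | inj₁ y<N  = below y y<N y∈ n (m⊔n≤o⇒m≤o n₀ (suc j) le)
  ... | inj₂ refl = content-complete T (m⊔n≤o⇒n≤o n₀ (suc j) le) eq
... | n₀ , below | false = n₀ , found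
  where
  found : ∀ y → y < suc N → L y ≡ true → ∀ n → n₀ ≤ n → testBit y (contentCode T n) ≡ true
  found y y<1+N y∈ n le with m≤n⇒m<n∨m≡n (s≤s⁻¹ y<1+N)
  ... | inj₁ y<N  = below y y<N y∈ n le
  ... | inj₂ refl = ⊥-elim (true≢false y∈ L-N)

-- Every later entry is a pause or already present, and inserting a present element leaves the code
-- itself unchanged.
content-stable : ∀ L {T} → TextFor T L → ∀ n₀ → (∀ y → L y ≡ true → testBit y (contentCode T n₀) ≡ true) →
                 ∀ d → contentCode T (d + n₀) ≡ contentCode T n₀
content-stable L T-text n₀ all zero = refl
content-stable L {T} T-text n₀ all (suc d) rewrite content-stable L T-text n₀ all d with T (d + n₀) in eq
... | nothing = refl
... | just y  = insertCode-present y (contentCode T n₀) (all y (proj₂ (T-text y) (d + n₀ , eq)))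

-- Position `n` holds `n` or a pause, so the content before `n` is `L` below `n`. This turns stages
-- of the diagonal construction into contents.
canonical : Lang → Text
canonical L n = if L n then just n else nothing

canonical⁻ : ∀ L n {y} → canonical L n ≡ just y → y ≡ n × L n ≡ true
canonical⁻ L n eq with L n
... | true = sym (just-injective eq) , refl

canonical-text : ∀ L → TextFor (canonical L) L
canonical-text L x = (λ x∈ → x , cong (λ b → if b then just x else nothing) x∈) , from
  where
  from : ∃[ n ] canonical L n ≡ just x → L x ≡ true
  from (n , eq) with refl , x∈ ← canonical⁻ L n eq = x∈

contentCode-canonical : ∀ L n → contentCode (canonical L) (suc n) ≡
  (if L n then contentCode (canonical L) n + 2 ^ n else contentCode (canonical L) n)
contentCode-canonical L n with L n
... | false = refl
... | true with testBit n (contentCode (canonical L) n) in eq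
...   | false = refl
-- Bit `n` would stem from an earlier position `j`, which can hold only `j`.
...   | true with j , j<n , eq′ ← content-sound (canonical L) n eq =
  ⊥-elim (<-irrefl (sym (proj₁ (canonical⁻ L j eq′))) j<n)

-- The diagonal languages

Index : Set
Index = Σ ℕ Total

value : Index → ℕ → ℕ
value (_ , total) x = proj₁ (total x)

valueF : Fn {Index × ℕ} (λ ((e , _) , x) → ⟪ e , x ⟫) (λ (E , x) → value E x)
valueF = onF (λ ((e , total) , x) → (e , x , proj₁ (total x)) , proj₂ (total x)) universalF inputF

module _ (E : Index) where

  -- `K` codes what was collected below `n`, so `K + 2 ^ n` adds `n`. While `K` is empty, the first
  -- number with the right tag is taken unconditionally: the language is never empty and its tag can
  -- be read off.
  accepts : ℕ → ℕ → Bool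
  accepts n K = (π₁ n ≡ᵇ proj₁ E) ∧ ((K ≡ᵇ 0) ∨ not (value E (K + 2 ^ n) ≡ᵇ value E K))

  stage : ℕ → ℕ
  stage zero    = 0
  stage (suc n) = if accepts n (stage n) then stage n + 2 ^ n else stage n

  diag : Lang
  diag n = accepts n (stage n)

  accepts-tag : ∀ n K → accepts n K ≡ true → π₁ n ≡ proj₁ E
  accepts-tag n K eq with π₁ n ≡ᵇ proj₁ E in tag
  ... | true = ≡ᵇ-true _ _ tag

  accepts-empty : ∀ n {K} → π₁ n ≡ proj₁ E → K ≡ 0 → accepts n K ≡ true
  accepts-empty n tag refl rewrite ≡ᵇ-refl tag = refl

  accepts-true : ∀ n K → accepts n K ≡ true → value E (K + 2 ^ n) ≡ value E K → K ≡ 0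
  accepts-true n K eq same rewrite ≡ᵇ-refl same with π₁ n ≡ᵇ proj₁ E | K ≡ᵇ 0 in empty
  ... | true | true = ≡ᵇ-true K 0 empty

  accepts-false : ∀ n K → π₁ n ≡ proj₁ E → ¬ K ≡ 0 → accepts n K ≡ false →
                  value E (K + 2 ^ n) ≡ value E K
  accepts-false n K tag K≢0 eq rewrite ≡ᵇ-refl tag with K ≡ᵇ 0 in empty
  ... | true = ⊥-elim (K≢0 (≡ᵇ-true K 0 empty))
  ... | false with value E (K + 2 ^ n) ≡ᵇ value E K in same
  ...   | true = ≡ᵇ-true _ _ same

  -- Stages never decrease, and an acceptance adds a positive power of two.
  stage-zero : ∀ n → stage n ≡ 0 → ∀ m → m < n → stage m ≡ 0 × diag m ≡ false
  stage-zero (suc n) eq m m<1+n with accepts n (stage n) in acc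
  ... | true  = ⊥-elim (<-irrefl (sym (m+n≡0⇒n≡0 (stage n) eq)) (m^n>0 2 n))
  ... | false with m≤n⇒m<n∨m≡n (s≤s⁻¹ m<1+n)
  ...   | inj₁ m<n  = stage-zero n eq m m<n
  ...   | inj₂ refl = eq , acc

  -- `⟪ proj₁ E , 0 ⟫` is merely some number with the right tag: had nothing been accepted before
  -- it, it would have been accepted itself.
  stage-nonzero : ∀ n → ⟪ proj₁ E , 0 ⟫ < n → ¬ stage n ≡ 0
  stage-nonzero n lt eq with eq′ , rejected ← stage-zero n eq _ lt =
    true≢false (accepts-empty _ (β₁ _ 0) eq′) rejected

  diag-inhabited : ∃[ y ] diag y ≡ true
  diag-inhabited with stage-member ⟪ proj₁ E , 0 ⟫
    where
    stage-member : ∀ n → (∃[ y ] diag y ≡ true) ⊎ stage n ≡ 0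
    stage-member zero = inj₂ refl
    stage-member (suc n) with accepts n (stage n) in acc
    ... | true  = inj₁ (n , acc)
    ... | false = stage-member n
  ... | inj₁ found = found
  ... | inj₂ empty = _ , accepts-empty _ (β₁ _ 0) empty

  -- Both sides obey the same recursion. Hence the value of `E` at a stage is a conjecture on a text
  -- for `diag`.
  content-stage : ∀ n → contentCode (canonical diag) n ≡ stage n
  content-stage zero    = refl
  content-stage (suc n) rewrite contentCode-canonical diag n | content-stage n = refl

acceptsF : ∀ {I i} (E : I → Index) {n K} → Fn {I} i (λ a → proj₁ (E a)) → Fn i n → Fn i K →
           Pred i (λ a → accepts (E a) (n a) (K a))
acceptsF {i = i} E e n K =
  andF (≡ᵇF (π₁F n) e) (orF (≡ᵇF K (constF 0)) (notF (≡ᵇF (valueAt (app₂ addF K (app₁ 2^F n))) (valueAt K))))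
  where
  valueAt : ∀ {u} → Fn i u → Fn i (λ a → value (E a) (u a))
  valueAt {u} f = onF (λ a → E a , u a) valueF (pairF e f)

stageF : Fn {Index × ℕ} (λ ((e , _) , n) → ⟪ e , n ⟫) (λ (E , n) → stage E n)
stageF = recF stage (constF 0) (ifF (acceptsF proj₁ (fstF inputF) n K) (app₂ addF K (app₁ 2^F n)) K)
  where
  n = fstF (sndF inputF)
  K = sndF (sndF inputF)

diagF : Pred {Index × ℕ} (λ ((e , _) , n) → ⟪ e , n ⟫) (λ (E , n) → diag E n)
diagF = acceptsF proj₁ (fstF inputF) (sndF inputF) stageF

adjoin : ℕ → Lang → Lang
adjoin x L y = L y ∨ (y ≡ᵇ x)

adjoin-self : ∀ x L → adjoin x L x ≡ true
adjoin-self x L rewrite ≡ᵇ-refl {x} refl = ∨-zeroʳ (L x)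

adjoin⁻ : ∀ x L y → adjoin x L y ≡ true → L y ≡ true ⊎ y ≡ x
adjoin⁻ x L y eq with L y
... | true  = inj₁ refl
... | false = inj₂ (≡ᵇ-true y x eq)

-- The bound `N` makes an extended language finite, so that its content can be conjectured; the tag
-- of `x` keeps the program number readable from any element.
data Family : Class where
  diagonal : ∀ E → Family (diag E)
  extended : ∀ E N x → (∀ y → N ≤ y → diag E y ≡ false) → π₁ x ≡ proj₁ E → diag E x ≡ false →
             Family (adjoin x (diag E))

-- The partial learner

-- Any member would do, as all members of a language in the family share one tag.
element : ℕ → ℕ → ℕ
element c zero    = 0
element c (suc n) = if testBit n c then n else element c n

elementF : Fn₂ element
elementF = recF element (constF 0) (ifF bitF n (sndF (sndF inputF)))
  where
  n = fstF (sndF inputF)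
  bitF = onF (λ (c , n) → c , n) testBitF (pairF (fstF inputF) n)

element-∈ : ∀ c n → testBit (element c n) c ≡ true ⊎ element c n ≡ 0
element-∈ c zero = inj₂ refl
element-∈ c (suc n) with testBit n c in eq
... | true  = inj₁ eq
... | false = element-∈ c n

element-found : ∀ c n y → y < n → testBit y c ≡ true → testBit (element c n) c ≡ true
element-found c (suc n) y y<1+n y∈c with testBit n c in eq
... | true = eq
... | false with m≤n⇒m<n∨m≡n (s≤s⁻¹ y<1+n)
...   | inj₁ y<n  = element-found c n y y<n y∈c
...   | inj₂ refl = ⊥-elim (true≢false y∈c eq)

tag : ℕ → ℕ
tag c = π₁ (element c c)

contained : Index → ℕ → ℕ → Bool
contained E c zero    = true
contained E c (suc n) = contained E c n ∧ (not (testBit n c) ∨ diag E n)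

contained-⊆ : ∀ E c n → (∀ y → testBit y c ≡ true → diag E y ≡ true) → contained E c n ≡ true
contained-⊆ E c zero    _   = refl
contained-⊆ E c (suc n) sub rewrite contained-⊆ E c n sub with testBit n c in eq
... | true  = sub n eq
... | false = refl

contained-⊈ : ∀ E c n y → y < n → testBit y c ≡ true → diag E y ≡ false → contained E c n ≡ false
contained-⊈ E c (suc n) y y<1+n y∈c y∉ with m≤n⇒m<n∨m≡n (s≤s⁻¹ y<1+n)
... | inj₁ y<n rewrite contained-⊈ E c n y y<n y∈c y∉ = refl
... | inj₂ refl rewrite y∈c | y∉ = ∧-zeroʳ _

containedF : Pred {(Index × ℕ) × ℕ} (λ (((e , _) , c) , n) → ⟪ ⟪ e , c ⟫ , n ⟫) (λ ((E , c) , n) → contained E c n)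
containedF = recF (λ (E , c) n → bit (contained E c n)) (constF 1)
  (andF {p = λ ((E , c) , n) → contained E c n} (sndF (sndF inputF))
    (orF (notF {p = λ ((E , c) , n) → testBit n c} bitF) diag-nF))
  where
  n = fstF (sndF inputF)
  bitF = onF (λ ((_ , c) , n) → c , n) testBitF (pairF (sndF (fstF inputF)) n)
  diag-nF = onF (λ ((E , _) , n) → E , n) diagF (pairF (fstF (fstF inputF)) n)

-- Indices of the conjectured languages.

φ-encode : ∀ c {x y} → Eval c x y → φ (encode c) x y
φ-encode c {x} {y} = subst (λ c → Eval c x y) (sym (decode-encode c))

decides⇒CIndexFor : ∀ p L → (∀ x → φ p x (bit (L x))) → CIndexFor p L
decides⇒CIndexFor p L decides = (λ x → _ , decides x , bit≤1 (L x)) , λ x → to x , from x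
  where
  bit≤1 : ∀ b → bit b ≡ 0 ⊎ bit b ≡ 1
  bit≤1 true  = inj₂ refl
  bit≤1 false = inj₁ refl
  to : ∀ x → φ p x 1 → L x ≡ true
  to x d with L x | decides x
  ... | true  | _  = refl
  ... | false | d′ with () ← Eval-functional d d′
  from : ∀ x → L x ≡ true → φ p x 1
  from x x∈ = subst (φ p x) (cong bit x∈) (decides x)

opaque
  diagIndex finiteIndex : ℕ → ℕ
  diagIndex e   = encode (specialize (code diagF) e)
  finiteIndex c = encode (specialize (code testBitF) c)

  diagIndexF : ∀ {I i u} → Fn {I} i u → Fn i (λ a → diagIndex (u a))
  diagIndexF = encode-specializeF (code diagF)

  finiteIndexF : ∀ {I i u} → Fn {I} i u → Fn i (λ a → finiteIndex (u a))
  finiteIndexF = encode-specializeF (code testBitF)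

  diagIndex-correct : ∀ E → CIndexFor (diagIndex (proj₁ E)) (diag E)
  diagIndex-correct (e , total) = decides⇒CIndexFor (encode (specialize (code diagF) e)) (diag (e , total)) λ x →
    φ-encode (specialize (code diagF) e) (Eval-specialize (run diagF ((e , total) , x)))

  finiteIndex-correct : ∀ c → CIndexFor (finiteIndex c) (λ x → testBit x c)
  finiteIndex-correct c = decides⇒CIndexFor (encode (specialize (code testBitF) c)) (λ x → testBit x c) λ x →
    φ-encode (specialize (code testBitF) c) (Eval-specialize (run testBitF (c , x)))

hypothesis : Index → ℕ → ℕ
hypothesis E c = if contained E c c then diagIndex (proj₁ E) else finiteIndex c

-- The code sees only `c` and uses `tag c` as program number; `E` supplies the totality that makes
-- the containment test converge.
learnerF : Fn {Σ (Index × ℕ) λ (E , c) → tag c ≡ proj₁ E} (λ ((_ , c) , _) → c) (λ ((E , c) , _) → hypothesis E c)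
learnerF = ifF (onF (λ ((E , c) , _) → (E , c) , c) containedF (pairF (pairF tagF inputF) inputF))
  (diagIndexF tagF) (finiteIndexF inputF)
  where
  tagF : Fn _ (λ ((E , _) , _) → proj₁ E)
  tagF = castF proj₂ (π₁F (app₂ elementF inputF inputF))

opaque
  learner : ℕ
  learner = encode (code learnerF)

  φ-learner : ∀ E c → tag c ≡ proj₁ E → φ learner c (hypothesis E c)
  φ-learner E c eq = φ-encode (code learnerF) (run learnerF ((E , c) , eq))

hypothesis-CIndex : ∀ E c → CIndex (hypothesis E c)
hypothesis-CIndex E c with contained E c c
... | true  = proj₁ (diagIndex-correct E)
... | false = proj₁ (finiteIndex-correct c)

CIndexFor-cong : ∀ p L L′ → (∀ x → L x ≡ true → L′ x ≡ true) → (∀ x → L′ x ≡ true → L x ≡ true) →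
                 CIndexFor p L → CIndexFor p L′
CIndexFor-cong p L L′ L⊆L′ L′⊆L (p-index , p-L) =
  p-index , λ x → (λ d → L⊆L′ x (proj₁ (p-L x) d)) , λ x∈ → proj₂ (p-L x) (L′⊆L x x∈)

member-tag : ∀ {L} → Family L → Σ Index λ E → ∀ y → L y ≡ true → π₁ y ≡ proj₁ E
member-tag (diagonal E) = E , λ y → accepts-tag E y _
member-tag (extended E N x _ x-tag _) = E , tagged
  where
  tagged : ∀ y → adjoin x (diag E) y ≡ true → π₁ y ≡ proj₁ E
  tagged y y∈ with adjoin⁻ x (diag E) y y∈
  ... | inj₁ y∈′  = accepts-tag E y _ y∈′
  ... | inj₂ refl = x-tag

opaque
  unfolding π₁

  π₁-zero : π₁ 0 ≡ 0
  π₁-zero = refl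

-- Code 0 is a program for the constant 0, so the default element 0 of the
-- empty set does no harm.
total-zero : Total 0
total-zero x = 0 , evZ

conjectures-CIndex : ∀ E c → (∀ y → testBit y c ≡ true → π₁ y ≡ proj₁ E) →
                     ∃[ p ] (φ learner c p × CIndex p)
conjectures-CIndex E c tagged with element-∈ c c
... | inj₁ found = _ , φ-learner E c (tagged _ found) , hypothesis-CIndex E c
... | inj₂ eq    = _ , φ-learner (0 , total-zero) c (trans (cong π₁ eq) π₁-zero) , hypothesis-CIndex (0 , total-zero) c

-- The witness `y` makes the content nonempty, so `element` returns a true member and not its
-- default.
conjecture : ∀ L E → (∀ y → L y ≡ true → π₁ y ≡ proj₁ E) → ∀ {T} → TextFor T L → ∀ y n →
             testBit y (contentCode T n) ≡ true → φ learner (contentCode T n) (hypothesis E (contentCode T n))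
conjecture L E tagged {T} T-text y n y∈ =
  φ-learner E c (tagged _ (content-⊆ L T-text n (element-found c c y (testBit⇒< y c y∈) y∈)))
  where
  c = contentCode T n

learner-learns : ∀ L → Family L → SdCIndExC-learns learner L
learner-learns L L∈ T T-text = cind , converges L∈ T-text
  where
  cind : ∀ i → ∃[ p ] (φ learner (contentCode T i) p × CIndex p)
  cind i with E , tagged ← member-tag L∈ =
    conjectures-CIndex E (contentCode T i) λ y y∈ → tagged y (content-⊆ L T-text i y∈)

  converges : ∀ {L} → Family L → TextFor T L →
    ∃[ n₀ ] ∃[ p ] (φ learner (contentCode T n₀) p × CIndexFor p L
                    × (∀ n → n₀ ≤ n → φ learner (contentCode T n) p))
  -- Once an element `y` has appeared, the tag is read correctly, and the content, always inside
  -- `diag E`, gives the same conjecture forever.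
  converges (diagonal E) T-text
    with y , y∈ ← diag-inhabited E
    with j , eq ← proj₁ (T-text y) y∈ =
    suc j , diagIndex (proj₁ E) , stable (suc j) ≤-refl , diagIndex-correct E , stable
    where
    stable : ∀ n → suc j ≤ n → φ learner (contentCode T n) (diagIndex (proj₁ E))
    stable n j<n = subst
      (λ b → φ learner (contentCode T n) (if b then diagIndex (proj₁ E) else finiteIndex (contentCode T n)))
      (contained-⊆ E (contentCode T n) (contentCode T n) (λ _ → content-⊆ (diag E) T-text n))
      (conjecture (diag E) E (λ y → accepts-tag E y _) T-text y n (content-complete T j<n eq))
  -- `N ⊔ suc x` exceeds every element, so the content is eventually the whole language; containing
  -- `x`, it fails the test against `diag E`.
  converges L∈@(extended E N x bound x-tag x∉) T-text
    with n₀ , exhausted ← content-exhausts (adjoin x (diag E)) T-text (N ⊔ suc x) =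
    n₀ , finiteIndex c , now , correct , stable
    where
    c = contentCode T n₀
    full : ∀ y → adjoin x (diag E) y ≡ true → testBit y c ≡ true
    full y y∈ = exhausted y (below (adjoin⁻ x (diag E) y y∈)) y∈ n₀ ≤-refl
      where
      below : diag E y ≡ true ⊎ y ≡ x → y < N ⊔ suc x
      below (inj₂ refl) = m≤n⊔m N (suc x)
      below (inj₁ y∈′) with y <? N
      ... | yes y<N = ≤-trans y<N (m≤m⊔n N (suc x))
      ... | no  y≮N = ⊥-elim (true≢false y∈′ (bound y (≮⇒≥ y≮N)))
    correct : CIndexFor (finiteIndex c) (adjoin x (diag E))
    correct = CIndexFor-cong (finiteIndex c) (λ y → testBit y c) (adjoin x (diag E))
      (λ _ → content-⊆ (adjoin x (diag E)) T-text n₀) full (finiteIndex-correct c)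
    x∈c : testBit x c ≡ true
    x∈c = full x (adjoin-self x (diag E))
    now : φ learner c (finiteIndex c)
    now = subst (λ b → φ learner c (if b then diagIndex (proj₁ E) else finiteIndex c))
      (contained-⊈ E c c x (testBit⇒< x c x∈c) x∈c x∉)
      (conjecture (adjoin x (diag E)) E (proj₂ (member-tag L∈)) T-text x n₀ x∈c)
    stable : ∀ n → n₀ ≤ n → φ learner (contentCode T n) (finiteIndex c)
    stable n n₀≤n = subst (λ d → φ learner d (finiteIndex c))
      (sym (trans (cong (contentCode T) (sym (m∸n+n≡m n₀≤n)))
                  (content-stable (adjoin x (diag E)) T-text n₀ full (n ∸ n₀)))) now

-- The final conjecture on the canonical text decides `L`.
learns⇒REC : ∀ h L → SdCIndExC-learns h L → REC L
learns⇒REC h L learns with _ , p , _ , correct , _ ← proj₂ (learns (canonical L) (canonical-text L)) = p , correct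

-- No total learner succeeds

module _ (e : ℕ) (total : Total e) (learns : ∀ L → Family L → SdCIndExC-learns e L) where
  private
    E : Index
    E = e , total

    limit : ∀ L → Family L → ∃[ n₀ ] ∃[ p ]
      (CIndexFor p L × (∀ n → n₀ ≤ n → value E (contentCode (canonical L) n) ≡ p))
    limit L L∈ with n₀ , p , _ , correct , stable ← proj₂ (learns L L∈ (canonical L) (canonical-text L)) =
      n₀ , p , correct , λ n n₀≤n → Eval-functional (proj₂ (total _)) (stable n n₀≤n)

  total-learner-fails : ⊥
  total-learner-fails with n₀ , p , correct , stable ← limit (diag E) (diagonal E) = contradiction
    where
    N x : ℕ
    -- From `n₀` on the conjecture is settled; past `⟪ e , 0 ⟫` the stage is nonempty.
    N = n₀ ⊔ suc ⟪ e , 0 ⟫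
    x = ⟪ e , N ⟫

    nonzero : ∀ n → N ≤ n → ¬ stage E n ≡ 0
    nonzero n N≤n = stage-nonzero E n (m⊔n≤o⇒n≤o n₀ _ N≤n)

    value-stage : ∀ n → N ≤ n → value E (stage E n) ≡ p
    value-stage n N≤n = trans (cong (value E) (sym (content-stage E n))) (stable n (m⊔n≤o⇒m≤o n₀ _ N≤n))

    -- A later acceptance into a nonempty stage would be a mind change, yet the values at `n` and
    -- `suc n` are both `p`.
    bound : ∀ n → N ≤ n → diag E n ≡ false
    bound n N≤n with diag E n in acc
    ... | false = refl
    ... | true  = ⊥-elim (nonzero n N≤n (accepts-true E n (stage E n) acc
      (trans (cong (value E) (sym added)) (trans (value-stage (suc n) (m≤n⇒m≤1+n N≤n)) (sym (value-stage n N≤n))))))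
      where
      added : stage E (suc n) ≡ stage E n + 2 ^ n
      added rewrite acc = refl

    N≤x : N ≤ x
    N≤x = ≤-pairʳ e N

    L : Lang
    L = adjoin x (diag E)

    L∈ : Family L
    L∈ = extended E N x bound (β₁ e N) (bound x N≤x)

    below : ∀ n → n ≤ x → contentCode (canonical L) n ≡ stage E n
    below zero    _   = refl
    below (suc n) n<x
      rewrite contentCode-canonical L n | below n (<⇒≤ n<x)
      with n ≡ᵇ x in eq
    ... | true  = ⊥-elim (<-irrefl (≡ᵇ-true n x eq) n<x)
    ... | false rewrite ∨-identityʳ (diag E n) = refl

    -- Neither `diag E` nor `x` contributes anything after position `x`.
    above : ∀ d → contentCode (canonical L) (d + suc x) ≡ stage E x + 2 ^ x
    above zero rewrite contentCode-canonical L x | below x ≤-refl | adjoin-self x (diag E) = refl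
    above (suc d)
      rewrite contentCode-canonical L (d + suc x) | above d
            | bound (d + suc x) (≤-trans (m≤n⇒m≤1+n N≤x) (m≤n+m (suc x) d))
      with d + suc x ≡ᵇ x in eq
    ... | true  = ⊥-elim (<-irrefl (sym (≡ᵇ-true (d + suc x) x eq)) (m≤n+m (suc x) d))
    ... | false = refl

    contradiction : ⊥
    contradiction with n₁ , q , correct′ , stable′ ← limit L L∈ =
      -- An index common to both languages would put `x` into `diag E`.
      true≢false (proj₁ (proj₂ correct x) (subst (λ p → φ p x 1) q≡p
                                            (proj₂ (proj₂ correct′ x) (adjoin-self x (diag E)))))
                 (bound x N≤x)
      where
      -- At `n₁ + suc x` the conjecture on `L` has settled to `q` and the content is
      -- `stage E x + 2 ^ x`. As `x` was rejected, the value there is the one at `stage E x`, which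
      -- is `p`.
      q≡p : q ≡ p
      q≡p = trans (sym (stable′ (n₁ + suc x) (m≤m+n n₁ (suc x))))
           (trans (cong (value E) (above n₁))
           (trans (accepts-false E x (stage E x) (β₁ e N) (nonzero x N≤x) (bound x N≤x))
                  (value-stage x N≤x)))

theorem5 : ((𝓛 : Class) → InRTxtSdCIndExC 𝓛 → InTxtSdCIndExC 𝓛)
    × (∃[ 𝓛 ] (InTxtSdCIndExC 𝓛 × ¬ InRTxtSdCIndExC 𝓛))
theorem5 = (λ 𝓛 (rec , h , _ , learns) → rec , h , learns)
         , Family
         , ((λ L L∈ → learns⇒REC learner L (learner-learns L L∈)) , learner , learner-learns)
         , λ (_ , e , total , learns) → total-learner-fails e total learns
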